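{- Let $n\geq 8$ be an integer with $n\not\equiv 1\pmod 3$, let $E=E(W_n)$ be the eccentricity matrix of the wheel graph $W_n$, and let $\mathbf{w}=\frac{1}{6}(7-n,1,\dots,1)'\in\mathbb{R}^n$. Let $\widetilde{L}$ be the $n\times n$ matrix $$\widetilde{L}=\frac{n-1}{3}I_n-\frac13\begin{bmatrix}0&\mathbf{e}'\\ \mathbf{e}&\mathbf{0}\end{bmatrix}+\begin{bmatrix}0&\mathbf{0}'\\ \mathbf{0}&M\end{bmatrix},$$ where $M=\frac13\operatorname{Circ}(\bar{\mathbf{x}}')$ if $n\equiv 2\pmod 3$ and $M=\frac13\operatorname{Circ}(\bar{\mathbf{y}}')$ if $n\equiv 0\pmod 3$, with $\bar{\mathbf{x}},\bar{\mathbf{y}}\in\mathbb{R}^{n-1}$ given by $$\bar{\mathbf{x}}=(2-n,\underbrace{1,-2,1},\dots,\underbrace{1,-2,1})',\qquad \bar{\mathbf{y}}=(-n,\underbrace{2,-1,-1},\dots,\underbrace{2,-1,-1},2)'.$$ Then $$E^{ -1}=-\frac12\widetilde{L}+\frac{6}{n-1}\mathbf{w}\mathbf{w}'.$$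
   Context: The prime denotes transpose, $I_n$ is the identity matrix, and $\mathbf{e}$ denotes the all-ones column vector (here in $\mathbb{R}^{n-1}$). In the block matrices the blocks have sizes $1$ and $n-1$. For a vector $\mathbf{c}=(c_1,\dots,c_m)'$, $\operatorname{Circ}(\mathbf{c}')$ is the $m\times m$ circulant matrix with first row $(c_1,c_2,\dots,c_m)$ and each subsequent row the cyclic right shift by one of the previous row (so the second row is $(c_m,c_1,\dots,c_{m-1})$). For a simple connected graph $G$ with vertices $v_1,\dots,v_n$, let $d(v_i,v_j)$ be the length of a shortest path between $v_i$ and $v_j$, and let $e(v_i)=\max\{d(v_i,v_j):1\le j\le n\}$. The eccentricity matrix $E(G)$ is the $n\times n$ real matrix with $(E(G))_{ij}=d(v_i,v_j)$ if $d(v_i,v_j)=\min\{e(v_i),e(v_j)\}$, and $(E(G))_{ij}=0$ otherwise. The wheel graph $W_n$ is the graph on $n$ vertices consisting of a cycle of length $n-1$ together with one further vertex (the hub) adjacent to every vertex of the cycle. The vertices are labelled so that $v_1$ is the hub and $v_2,\dots,v_n$ are the cycle vertices in cyclic order. -}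

module Defs where

open import Data.Bool.Base using (if_then_else_)
open import Data.Fin.Base using (Fin; zero; suc; toℕ)
import Data.Fin.Properties as Fin
open import Data.Integer.Base using (+_)
open import Data.List.Base using (List; []; _∷_)
open import Data.List.Membership.Propositional using (_∉_)
import Data.List.Membership.DecPropositional as DecMembership
open import Data.List.Relation.Unary.All using (All; []; _∷_)
import Data.List.Relation.Unary.All as All
open import Data.List.Relation.Unary.Any using (here; there)
open import Data.List.Relation.Unary.AllPairs using ([]; _∷_)
open import Data.List.Relation.Unary.Unique.Propositional using (Unique)
open import Data.Nat.Base as ℕ using (ℕ; zero; suc; _≤_; _⊔_; _⊓_; z≤n; s≤s; NonZero; >-nonZero)
open import Data.Nat.DivMod using (_%_)
import Data.Nat.Properties as ℕ
open import Data.Nat.GeneralisedArithmetic using (fold)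
open import Data.Product.Base using (∃; ∃-syntax; Σ-syntax; _×_; _,_; proj₁)
open import Data.Rational.Base using (ℚ; 0ℚ; 1ℚ; _+_; _-_; _*_; -_; _/_)
open import Data.Rational.Properties using (+-0-commutativeMonoid)
open import Data.Sum.Base using (_⊎_; inj₁; inj₂; swap)
open import Data.Vec.Functional as Vector using (Vector)
open import Algebra.Properties.CommutativeMonoid.Sum +-0-commutativeMonoid using (sum)
open import Relation.Binary.PropositionalEquality using (_≡_; _≢_; refl; sym; trans; cong)
open import Relation.Nullary using (Dec; yes; no; ¬_; does; contradiction)
open import Relation.Nullary.Decidable using (map′; ¬?; _×-dec_; _⊎-dec_)
open import Relation.Unary using (Decidable)

record Graph (n : ℕ) : Set₁ where
  field
    Adj       : Fin n → Fin n → Set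
    adj?      : ∀ u v → Dec (Adj u v)
    symmetric : ∀ {u v} → Adj u v → Adj v u
    loopless  : ∀ {u} → ¬ Adj u u

least : ∀ {P : ℕ → Set} → Decidable P → ∀ k → P k →
        ∃[ k ] (P k × (∀ l → P l → k ≤ l))
least P? zero    p = zero , p , λ _ _ → z≤n
least P? (suc k) p with P? zero
... | yes p₀ = zero , p₀ , λ _ _ → z≤n
... | no ¬p₀ with least (λ l → P? (suc l)) k p
...   | j , pj , minimal = suc j , pj , λ where
        zero    p₀ → contradiction p₀ ¬p₀
        (suc l) pl → s≤s (minimal l pl)

module _ {n : ℕ} (G : Graph n) where
  open Graph G
  open DecMembership (Fin._≟_ {n}) using (_∈?_)

  data Walk : Fin n → Fin n → ℕ → Set where
    nil  : ∀ {u} → Walk u u zero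
    cons : ∀ {u w v k} → Adj u w → Walk w v k → Walk u v (suc k)

  vertices : ∀ {u v k} → Walk u v k → List (Fin n)
  vertices {u} nil        = u ∷ []
  vertices {u} (cons _ p) = u ∷ vertices p

  Path : Fin n → Fin n → ℕ → Set
  Path u v k = Σ[ p ∈ Walk u v k ] Unique (vertices p)

  Connected : Set
  Connected = ∀ u v → ∃ (Path u v)

  -- Existence of a path is decided by searching for one that avoids the
  -- vertices already visited.

  private
    AvoidingPath : List (Fin n) → Fin n → Fin n → ℕ → Set
    AvoidingPath S u v k =
      Σ[ p ∈ Walk u v k ] (Unique (vertices p) × All (_∉ S) (vertices p))

    avoidingPath? : ∀ S u v k → Dec (AvoidingPath S u v k)
    avoidingPath? S u v zero =
      map′ (λ where (refl , u∉S) → nil , ([] ∷ []) , (u∉S ∷ []))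
           (λ where (nil , _ , u∉S ∷ _) → refl , u∉S)
           (u Fin.≟ v ×-dec ¬? (u ∈? S))
    avoidingPath? S u v (suc k) =
      map′ to from
        (¬? (u ∈? S) ×-dec
         Fin.any? (λ w → adj? u w ×-dec avoidingPath? (u ∷ S) w v k))
      where
      to : u ∉ S × (∃[ w ] (Adj u w × AvoidingPath (u ∷ S) w v k)) →
           AvoidingPath S u v (suc k)
      to (u∉S , w , a , p , uniq , avoid) =
        cons a p ,
        (All.map (λ x∉ u≡x → x∉ (here (sym u≡x))) avoid ∷ uniq) ,
        (u∉S ∷ All.map (λ x∉ x∈S → x∉ (there x∈S)) avoid)

      from : AvoidingPath S u v (suc k) →
             u ∉ S × (∃[ w ] (Adj u w × AvoidingPath (u ∷ S) w v k))
      from (cons a p , u≢ ∷ uniq , u∉S ∷ avoid) =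
        u∉S , _ , a , p , uniq ,
        All.zipWith (λ where
          (u≢x , x∉S) (here x≡u)  → u≢x (sym x≡u)
          (u≢x , x∉S) (there x∈S) → x∉S x∈S) (u≢ , avoid)

  path? : ∀ u v k → Dec (Path u v k)
  path? u v k =
    map′ (λ (p , uniq , _) → p , uniq)
         (λ (p , uniq) → p , uniq , All.universal (λ _ ()) (vertices p))
         (avoidingPath? [] u v k)

  module _ (connected : Connected) where

    shortestPath : ∀ u v → ∃[ k ] (Path u v k × (∀ l → Path u v l → k ≤ l))
    shortestPath u v = let k , p = connected u v in least (path? u v) k p

    distance : Fin n → Fin n → ℕ
    distance u v = proj₁ (shortestPath u v)

    eccentricity : Fin n → ℕ
    eccentricity u = Vector.foldr _⊔_ 0 (distance u)

module _ (m : ℕ) where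

  CyclicSuc : Fin m → Fin m → Set
  CyclicSuc i j = (toℕ j ≡ suc (toℕ i)) ⊎ (suc (toℕ i) ≡ m × toℕ j ≡ 0)

  cyclicSuc? : ∀ i j → Dec (CyclicSuc i j)
  cyclicSuc? i j =
    (toℕ j ℕ.≟ suc (toℕ i)) ⊎-dec (suc (toℕ i) ℕ.≟ m ×-dec toℕ j ℕ.≟ 0)

  cyclicSuc-irreflexive : 3 ≤ m → ∀ {i} → ¬ CyclicSuc i i
  cyclicSuc-irreflexive _ (inj₁ eq) = ℕ.1+n≢n (sym eq)
  cyclicSuc-irreflexive 3≤m (inj₂ (last , first))
    with s≤s () ← ℕ.≤-trans 3≤m (ℕ.≤-reflexive (trans (sym last) (cong suc first)))

cycle : (m : ℕ) → 3 ≤ m → Graph m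
cycle m 3≤m = record
  { Adj       = λ i j → CyclicSuc m i j ⊎ CyclicSuc m j i
  ; adj?      = λ i j → cyclicSuc? m i j ⊎-dec cyclicSuc? m j i
  ; symmetric = swap
  ; loopless  = λ where
      (inj₁ s) → cyclicSuc-irreflexive m 3≤m s
      (inj₂ s) → cyclicSuc-irreflexive m 3≤m s
  }

module _ {m : ℕ} (G : Graph m) where
  open Graph G

  data ConeAdj : Fin (suc m) → Fin (suc m) → Set where
    hub-rim : ∀ {i}   → ConeAdj zero (suc i)
    rim-hub : ∀ {i}   → ConeAdj (suc i) zero
    rim-rim : ∀ {i j} → Adj i j → ConeAdj (suc i) (suc j)

  private
    coneAdj? : ∀ u v → Dec (ConeAdj u v)
    coneAdj? zero    zero    = no λ ()
    coneAdj? zero    (suc _) = yes hub-rim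
    coneAdj? (suc _) zero    = yes rim-hub
    coneAdj? (suc i) (suc j) = map′ rim-rim (λ where (rim-rim a) → a) (adj? i j)

  cone : Graph (suc m)
  cone = record
    { Adj       = ConeAdj
    ; adj?      = coneAdj?
    ; symmetric = λ where
        hub-rim     → rim-hub
        rim-hub     → hub-rim
        (rim-rim a) → rim-rim (symmetric a)
    ; loopless  = λ where (rim-rim a) → loopless a
    }

  cone-connected : Connected cone
  cone-connected zero    zero    = 0 , nil , ([] ∷ [])
  cone-connected zero    (suc j) =
    1 , cons hub-rim nil , (((λ ()) ∷ []) ∷ [] ∷ [])
  cone-connected (suc i) zero    =
    1 , cons rim-hub nil , (((λ ()) ∷ []) ∷ [] ∷ [])
  cone-connected (suc i) (suc j) with i Fin.≟ j
  ... | yes refl = 0 , nil , ([] ∷ [])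
  ... | no  i≢j  =
    2 , cons rim-hub (cons hub-rim nil) ,
    (((λ ()) ∷ (λ eq → i≢j (Fin.suc-injective eq)) ∷ []) ∷
     ((λ ()) ∷ []) ∷ [] ∷ [])

-- The wheel on n = suc m vertices: the hub is zero, and the rim vertices are
-- suc i in cyclic order.
wheel : (m : ℕ) → 4 ≤ suc m → Graph (suc m)
wheel m 4≤n = cone (cycle m (ℕ.s≤s⁻¹ 4≤n))

wheel-connected : ∀ m (4≤n : 4 ≤ suc m) → Connected (wheel m 4≤n)
wheel-connected m 4≤n = cone-connected (cycle m (ℕ.s≤s⁻¹ 4≤n))

-- All matrices involved have rational entries, so inverses over ℝ and over ℚ
-- agree.

Matrix : ℕ → ℕ → Set
Matrix m n = Vector (Vector ℚ n) m

infixl 6 _⊞_ _⊟_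
infixl 7 _⊠_ _∙_

_⊞_ _⊟_ : ∀ {m n} → Matrix m n → Matrix m n → Matrix m n
(A ⊞ B) i j = A i j + B i j
(A ⊟ B) i j = A i j - B i j

_⊠_ : ∀ {l m n} → Matrix l m → Matrix m n → Matrix l n
(A ⊠ B) i j = sum (λ k → A i k * B k j)

_∙_ : ∀ {m n} → ℚ → Matrix m n → Matrix m n
(c ∙ A) i j = c * A i j

𝟎 : ∀ {m n} → Matrix m n
𝟎 _ _ = 0ℚ

𝐈 : ∀ {n} → Matrix n n
𝐈 i j = if does (i Fin.≟ j) then 1ℚ else 0ℚ

outer : ∀ {m n} → Vector ℚ m → Vector ℚ n → Matrix m n
outer u v i j = u i * v j

block : ∀ {m n} → ℚ → Vector ℚ n → Vector ℚ m → Matrix m n →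
        Matrix (suc m) (suc n)
block a r c D zero    = a Vector.∷ r
block a r c D (suc i) = c i Vector.∷ D i

rotateRight : ∀ {n} → Vector ℚ n → Vector ℚ n
rotateRight {zero}  c = c
rotateRight {suc _} c = Vector.last c Vector.∷ Vector.init c

Circ : ∀ {n} → Vector ℚ n → Matrix n n
Circ c i = fold c rotateRight (toℕ i)

infix 4 _≈ᴹ_ _HasInverse_

_≈ᴹ_ : ∀ {m n} → Matrix m n → Matrix m n → Set
A ≈ᴹ B = ∀ i j → A i j ≡ B i j

_HasInverse_ : ∀ {n} → Matrix n n → Matrix n n → Set
A HasInverse B = A ⊠ B ≈ᴹ 𝐈 × B ⊠ A ≈ᴹ 𝐈

fromℕ : ℕ → ℚ
fromℕ k = + k / 1

eccentricityMatrix : ∀ {n} (G : Graph n) → Connected G → Matrix n n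
eccentricityMatrix G con i j =
  if does (d i j ℕ.≟ e i ⊓ e j) then fromℕ (d i j) else 0ℚ
  where
  d = distance G con
  e = eccentricity G con

⅓ ⅙ : ℚ
⅓ = + 1 / 3
⅙ = + 1 / 6

periodic : ℚ → ℚ → ℚ → ℕ → ℚ
periodic a b c 0                   = a
periodic a b c 1                   = b
periodic a b c 2                   = c
periodic a b c (suc (suc (suc k))) = periodic a b c k

-- Throughout, n = suc m, so x̄ and ȳ have length m.  For n ≡ 2 (mod 3) the
-- tail of x̄ consists of whole blocks; for n ≡ 0 (mod 3) the tail of ȳ ends
-- with a lone 2.

x̄ ȳ : ∀ m → Vector ℚ m
x̄ m zero    = fromℕ 2 - fromℕ (suc m)
x̄ m (suc i) = periodic 1ℚ (- fromℕ 2) 1ℚ (toℕ i)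
ȳ m zero    = - fromℕ (suc m)
ȳ m (suc i) = periodic (fromℕ 2) (- 1ℚ) (- 1ℚ) (toℕ i)

-- Only meaningful for n ≢ 1 (mod 3), so that the second branch is n ≡ 0.
M : ∀ m → Matrix m m
M m = if does (suc m % 3 ℕ.≟ 2) then ⅓ ∙ Circ (x̄ m) else ⅓ ∙ Circ (ȳ m)

𝐞 : ∀ {m} → Vector ℚ m
𝐞 _ = 1ℚ

L̃ : ∀ m → Matrix (suc m) (suc m)
L̃ m = ((fromℕ (suc m) - 1ℚ) * ⅓) ∙ 𝐈
    ⊟ ⅓ ∙ block 0ℚ 𝐞 𝐞 𝟎
    ⊞ block 0ℚ (λ _ → 0ℚ) (λ _ → 0ℚ) (M m)

𝐰 : ∀ m → Vector ℚ (suc m)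
𝐰 m = Vector.map (⅙ *_) ((fromℕ 7 - fromℕ (suc m)) Vector.∷ 𝐞)

8≤n⇒4≤n : ∀ {n} → 8 ≤ n → 4 ≤ n
8≤n⇒4≤n = ℕ.≤-trans (ℕ.m≤m+n 4 4)

8≤n⇒nonZero[n-1] : ∀ {m} → 8 ≤ suc m → NonZero m
8≤n⇒nonZero[n-1] 8≤n = >-nonZero (ℕ.≤-trans (ℕ.m≤m+n 1 6) (ℕ.s≤s⁻¹ 8≤n))

6/[n-1] : ∀ m → 8 ≤ suc m → ℚ
6/[n-1] m 8≤n = (+ 6 / m) {{8≤n⇒nonZero[n-1] 8≤n}}

{-# OPTIONS --safe #-}
module Submission where

-- On the rim E is 2(J − I − C), with C the adjacency matrix of the cycle.  In
-- the claimed inverse the multiple of I cancels against the first entry of x̄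
-- or ȳ: with m = n − 1 and r = 6/m, its rim block has entries
-- (r/6 − P ∣i − j∣)/6, where P is the 3-periodic sequence 1, 1, −2, … or
-- −1, 2, −1, …  In both cases P is symmetric under k ↦ m − k, any three
-- consecutive values sum to 0, and P 0 + 2 P 1 = 3.  Hence the values of
-- P ∣i − j∣ at i and its two cyclic neighbours sum to 3 δᵢⱼ, which gives the
-- rim block of E E⁻¹ and, summed over i, the column sums Σᵢ P ∣i − j∣ = 1 needed
-- for the other blocks.  Both matrices are symmetric, so one product suffices.

open import Defs
open import Algebra.Bundles using (CommutativeRing)
open import Data.Bool.Base using (if_then_else_; true; false)
open import Data.Fin.Base as Fin using (Fin; zero; suc; toℕ; inject₁)
import Data.Fin.Permutation as Perm
import Data.Fin.Properties as Fin
open import Data.Fin.Relation.Unary.Top using (view; view-fromℕ; view-inject₁; ‵fromℕ; ‵inject₁)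
open import Data.Nat.Base as ℕ using (ℕ; zero; suc; _≤_; _<_; _⊔_; _⊓_; ∣_-_∣; z≤n; s≤s)
open import Data.Nat.DivMod using (_%_; m%n<n)
open import Data.Nat.GeneralisedArithmetic using (fold)
import Data.Nat.Properties as ℕ
import Data.Integer.Base as ℤ
open import Data.Integer.Solver using () renaming (module +-*-Solver to ℤSolver)
open import Data.Product.Base using (_,_; ∃-syntax; _×_)
open import Data.Rational.Base as ℚ using (ℚ; 0ℚ; 1ℚ; ½; _+_; _-_; _*_; -_; _/_)
import Data.Rational.Properties as ℚ
open import Data.Rational.Unnormalised.Base as ℚᵘ using (mkℚᵘ; *≡*)
import Data.Rational.Unnormalised.Properties as ℚᵘ
open import Data.Rational.Solver using (module +-*-Solver)
open import Data.Sum.Base using (inj₁; inj₂)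
open import Data.Vec.Functional as Vector using (Vector)
open import Function.Base using (_∘_)
open import Data.List.Relation.Unary.All using ([]; _∷_)
open import Data.List.Relation.Unary.AllPairs using ([]; _∷_)
open import Relation.Binary.PropositionalEquality
open import Algebra.Properties.CommutativeMonoid.Sum ℚ.+-0-commutativeMonoid
  using (sum; sum-cong-≗; sum-permute; ∑-distrib-+)
open import Algebra.Properties.Semiring.Sum (CommutativeRing.semiring ℚ.+-*-commutativeRing)
  using (*-distribˡ-sum)
import Relation.Binary.Reasoning.Setoid as ≈-Reasoning
open import Relation.Nullary using (yes; no; ¬_; contradiction)
open import Relation.Nullary.Decidable using (dec-true; dec-false)

-- Arithmetic of the rationals `fromℕ k` and `6 / m`.

fromℚᵘ-homo-+ : ∀ p q → ℚ.fromℚᵘ (p ℚᵘ.+ q) ≡ ℚ.fromℚᵘ p + ℚ.fromℚᵘ q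
fromℚᵘ-homo-+ p q = ℚ.toℚᵘ-injective (begin
  ℚ.toℚᵘ (ℚ.fromℚᵘ (p ℚᵘ.+ q))                    ≈⟨ ℚ.toℚᵘ-fromℚᵘ (p ℚᵘ.+ q) ⟩
  p ℚᵘ.+ q                                        ≈⟨ ℚᵘ.+-cong (ℚ.toℚᵘ-fromℚᵘ p) (ℚ.toℚᵘ-fromℚᵘ q) ⟨
  ℚ.toℚᵘ (ℚ.fromℚᵘ p) ℚᵘ.+ ℚ.toℚᵘ (ℚ.fromℚᵘ q)    ≈⟨ ℚ.toℚᵘ-homo-+ (ℚ.fromℚᵘ p) (ℚ.fromℚᵘ q) ⟨
  ℚ.toℚᵘ (ℚ.fromℚᵘ p + ℚ.fromℚᵘ q)                ∎)
  where open ≈-Reasoning ℚᵘ.≃-setoid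

fromℚᵘ-homo-* : ∀ p q → ℚ.fromℚᵘ (p ℚᵘ.* q) ≡ ℚ.fromℚᵘ p * ℚ.fromℚᵘ q
fromℚᵘ-homo-* p q = ℚ.toℚᵘ-injective (begin
  ℚ.toℚᵘ (ℚ.fromℚᵘ (p ℚᵘ.* q))                    ≈⟨ ℚ.toℚᵘ-fromℚᵘ (p ℚᵘ.* q) ⟩
  p ℚᵘ.* q                                        ≈⟨ ℚᵘ.*-cong (ℚ.toℚᵘ-fromℚᵘ p) (ℚ.toℚᵘ-fromℚᵘ q) ⟨
  ℚ.toℚᵘ (ℚ.fromℚᵘ p) ℚᵘ.* ℚ.toℚᵘ (ℚ.fromℚᵘ q)    ≈⟨ ℚ.toℚᵘ-homo-* (ℚ.fromℚᵘ p) (ℚ.fromℚᵘ q) ⟨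
  ℚ.toℚᵘ (ℚ.fromℚᵘ p * ℚ.fromℚᵘ q)                ∎)
  where open ≈-Reasoning ℚᵘ.≃-setoid

-- Normalisation blocks direct computation with `_/_`. On unnormalised fractions the identity
-- becomes a cross-multiplied equation of integers.
fromℕ-suc : ∀ k → fromℕ (suc k) ≡ 1ℚ + fromℕ k
fromℕ-suc k = trans
  (ℚ.fromℚᵘ-cong {mkℚᵘ (ℤ.+ suc k) 0} {ℚᵘ.1ℚᵘ ℚᵘ.+ mkℚᵘ (ℤ.+ k) 0}
    (*≡* (solve 1 (λ k → (con (ℤ.+ 1) :+ k) :* con (ℤ.+ 1) :=
                         (con (ℤ.+ 1) :* con (ℤ.+ 1) :+ k :* con (ℤ.+ 1)) :* con (ℤ.+ 1))
            refl (ℤ.+ k))))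
  (fromℚᵘ-homo-+ ℚᵘ.1ℚᵘ (mkℚᵘ (ℤ.+ k) 0))
  where open ℤSolver

-- The only fact about `6 / m` that enters the matrix computations, which otherwise treat it as an
-- indeterminate `r`.
6/m*m≡6 : ∀ k → ℤ.+ 6 / suc k * fromℕ (suc k) ≡ fromℕ 6
6/m*m≡6 k = trans
  (sym (fromℚᵘ-homo-* (mkℚᵘ (ℤ.+ 6) k) (mkℚᵘ (ℤ.+ suc k) 0)))
  (ℚ.fromℚᵘ-cong {mkℚᵘ (ℤ.+ 6) k ℚᵘ.* mkℚᵘ (ℤ.+ suc k) 0} {mkℚᵘ (ℤ.+ 6) 0}
    (*≡* (solve 1 (λ m → con (ℤ.+ 6) :* m :* con (ℤ.+ 1) := con (ℤ.+ 6) :* (m :* con (ℤ.+ 1)))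
            refl (ℤ.+ suc k))))
  where open ℤSolver

-- Cyclic neighbours on the rim.

module _ {k : ℕ} where

  -- Functions rather than the relation `CyclicSuc`, because sums are reindexed along bijections.
  prev next : Fin (suc k) → Fin (suc k)
  prev zero    = Fin.fromℕ k
  prev (suc i) = inject₁ i
  next i with view i
  ... | ‵fromℕ     = zero
  ... | ‵inject₁ j = suc j

  next-prev : ∀ i → next (prev i) ≡ i
  next-prev zero    rewrite view-fromℕ k = refl
  next-prev (suc i) rewrite view-inject₁ i = refl

  prev-next : ∀ i → prev (next i) ≡ i
  prev-next i with view i
  ... | ‵fromℕ     = refl
  ... | ‵inject₁ j = refl

  sum-∘-prev : (f : Vector ℚ (suc k)) → sum (f ∘ prev) ≡ sum f
  sum-∘-prev f = sym (sum-permute f (Perm.permutation prev next prev-next next-prev))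

  sum-∘-next : (f : Vector ℚ (suc k)) → sum (f ∘ next) ≡ sum f
  sum-∘-next f = sym (sum-permute f (Perm.permutation next prev next-prev prev-next))

  cyclicSuc-next : ∀ i → CyclicSuc (suc k) i (next i)
  cyclicSuc-next i with view i
  ... | ‵fromℕ     = inj₂ (cong suc (Fin.toℕ-fromℕ k) , refl)
  ... | ‵inject₁ j = inj₁ (cong suc (sym (Fin.toℕ-inject₁ j)))

  cyclicSuc-prev : ∀ i → CyclicSuc (suc k) (prev i) i
  cyclicSuc-prev i = subst (CyclicSuc _ (prev i)) (next-prev i) (cyclicSuc-next (prev i))

  cyclicSuc-functional : ∀ {i j j′} → CyclicSuc (suc k) i j → CyclicSuc (suc k) i j′ → j ≡ j′
  cyclicSuc-functional (inj₁ p) (inj₁ q) = Fin.toℕ-injective (trans p (sym q))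
  cyclicSuc-functional (inj₂ (_ , p)) (inj₂ (_ , q)) = Fin.toℕ-injective (trans p (sym q))
  -- In the mixed cases `i` is the last vertex, so its plain successor would have the index `suc k`,
  -- which is out of range.
  cyclicSuc-functional {j = j} (inj₁ p) (inj₂ (q , _)) =
    contradiction (trans p q) (ℕ.<⇒≢ (Fin.toℕ<n j))
  cyclicSuc-functional {j′ = j} (inj₂ (q , _)) (inj₁ p) =
    contradiction (trans p q) (ℕ.<⇒≢ (Fin.toℕ<n j))

  cyclicSuc⇒next : ∀ {i j} → CyclicSuc (suc k) i j → next i ≡ j
  cyclicSuc⇒next {i} = cyclicSuc-functional (cyclicSuc-next i)

  cyclicSuc⇒prev : ∀ {i j} → CyclicSuc (suc k) j i → prev i ≡ j
  cyclicSuc⇒prev {i} {j} s = trans (cong prev (sym (cyclicSuc⇒next s))) (prev-next j)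

  -- Two plain steps raise an index by 2 and cannot return to it; one wrap-around forces `suc k` to
  -- be 2, and two force it to be 1.
  cyclicSuc-asym : 3 ≤ suc k → ∀ {i j} → CyclicSuc (suc k) i j → ¬ CyclicSuc (suc k) j i
  cyclicSuc-asym _ {i} (inj₁ p) (inj₁ q) =
    ℕ.<⇒≢ (ℕ.m≤n+m (suc (toℕ i)) 1) (trans q (cong suc p))
  cyclicSuc-asym 3≤m (inj₁ p) (inj₂ (q , z))
    with s≤s (s≤s ()) ← subst (3 ≤_) (trans (sym q) (cong suc (trans p (cong suc z)))) 3≤m
  cyclicSuc-asym 3≤m (inj₂ (q , z)) (inj₁ p)
    with s≤s (s≤s ()) ← subst (3 ≤_) (trans (sym q) (cong suc (trans p (cong suc z)))) 3≤m
  cyclicSuc-asym 3≤m (inj₂ (q , z)) (inj₂ (_ , z′))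
    with s≤s () ← subst (3 ≤_) (trans (sym q) (cong suc z′)) 3≤m

  next≢prev : 3 ≤ suc k → ∀ i → next i ≢ prev i
  next≢prev 3≤m i eq = cyclicSuc-asym 3≤m (cyclicSuc-next i)
    (subst (λ j → CyclicSuc _ j i) (sym eq) (cyclicSuc-prev i))

-- Finite sums and the identity matrix.

sum-const : ∀ k c → sum {k} (λ _ → c) ≡ fromℕ k * c
sum-const zero    c = sym (ℚ.*-zeroˡ c)
sum-const (suc k) c = begin
  c + sum {k} (λ _ → c)  ≡⟨ cong (c +_) (sum-const k c) ⟩
  c + fromℕ k * c        ≡⟨ solve 2 (λ c k → c :+ k :* c := (con 1ℚ :+ k) :* c) refl c (fromℕ k) ⟩
  (1ℚ + fromℕ k) * c     ≡⟨ cong (_* c) (fromℕ-suc k) ⟨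
  fromℕ (suc k) * c      ∎
  where
  open ≡-Reasoning
  open +-*-Solver

sum-zero : ∀ k → sum {k} (λ _ → 0ℚ) ≡ 0ℚ
sum-zero k = trans (sum-const k 0ℚ) (ℚ.*-zeroʳ (fromℕ k))

𝐈-diag : ∀ {n} (i : Fin n) → 𝐈 i i ≡ 1ℚ
𝐈-diag i = cong (if_then 1ℚ else 0ℚ) (dec-true (i Fin.≟ i) refl)

𝐈-off-diag : ∀ {n} {i j : Fin n} → i ≢ j → 𝐈 i j ≡ 0ℚ
𝐈-off-diag {i = i} {j} i≢j = cong (if_then 1ℚ else 0ℚ) (dec-false (i Fin.≟ j) i≢j)

𝐈-sym : ∀ {n} (i j : Fin n) → 𝐈 i j ≡ 𝐈 j i
𝐈-sym i j with i Fin.≟ j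
... | yes refl = sym (𝐈-diag i)
... | no  i≢j  = sym (𝐈-off-diag (i≢j ∘ sym))

sum-𝐈 : ∀ {n} (i : Fin n) (f : Vector ℚ n) → sum (λ j → 𝐈 i j * f j) ≡ f i
sum-𝐈 {suc n} zero f = begin
  1ℚ * f zero + sum (λ j → 0ℚ * f (suc j))
    ≡⟨ cong (1ℚ * f zero +_) (trans (sum-cong-≗ (λ j → ℚ.*-zeroˡ (f (suc j)))) (sum-zero n)) ⟩
  1ℚ * f zero + 0ℚ
    ≡⟨ trans (ℚ.+-identityʳ _) (ℚ.*-identityˡ _) ⟩
  f zero ∎
  where open ≡-Reasoning
sum-𝐈 (suc i) f = trans (cong₂ _+_ (ℚ.*-zeroˡ (f zero)) (sum-𝐈 i (f ∘ suc))) (ℚ.+-identityˡ _)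

-- Distances and eccentricities in a general graph.

foldr-⊔-≤ : ∀ {n b} (f : Vector ℕ n) → (∀ i → f i ≤ b) → Vector.foldr _⊔_ 0 f ≤ b
foldr-⊔-≤ {zero}  f f≤b = z≤n
foldr-⊔-≤ {suc n} f f≤b = ℕ.⊔-lub (f≤b zero) (foldr-⊔-≤ (f ∘ suc) (f≤b ∘ suc))

≤-foldr-⊔ : ∀ {n} (f : Vector ℕ n) i → f i ≤ Vector.foldr _⊔_ 0 f
≤-foldr-⊔ f zero    = ℕ.m≤m⊔n _ _
≤-foldr-⊔ f (suc i) = ℕ.≤-trans (≤-foldr-⊔ (f ∘ suc) i) (ℕ.m≤n⊔m (f zero) _)

module _ {n : ℕ} (G : Graph n) (con : Connected G) where
  open Graph G

  -- `distance` is the outcome of a search. Exhibiting a shortest path determines its value without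
  -- evaluating that search.
  distance-unique : ∀ {u v k} → Path G u v k → (∀ l → Path G u v l → k ≤ l) →
                    distance G con u v ≡ k
  distance-unique {u} {v} p minimal =
    let _ , q , minimal′ = shortestPath G con u v in
    ℕ.≤-antisym (minimal′ _ p) (minimal _ q)

  distance-refl : ∀ u → distance G con u u ≡ 0
  distance-refl u = distance-unique (nil , ([] ∷ [])) (λ _ _ → z≤n)

  distance-adjacent : ∀ {u v} → Adj u v → distance G con u v ≡ 1
  distance-adjacent a = distance-unique
    (cons a nil , (((λ where refl → loopless a) ∷ []) ∷ [] ∷ []))
    λ where
      zero    (nil , _) → contradiction a loopless
      (suc l) _         → s≤s z≤n

  distance-via : ∀ {u w v} → Adj u w → Adj w v → u ≢ v → ¬ Adj u v → distance G con u v ≡ 2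
  distance-via a b u≢v ¬uv = distance-unique
    (cons a (cons b nil) ,
     ((λ where refl → loopless a) ∷ u≢v ∷ []) ∷ ((λ where refl → loopless b) ∷ []) ∷ [] ∷ [])
    λ where
      zero          (nil , _)        → contradiction refl u≢v
      (suc zero)    (cons c nil , _) → contradiction c ¬uv
      (suc (suc l)) _                → s≤s (s≤s z≤n)

  eccentricity-unique : ∀ {u v b} → (∀ w → distance G con u w ≤ b) → distance G con u v ≡ b →
                        eccentricity G con u ≡ b
  eccentricity-unique {u} {v} bound refl =
    ℕ.≤-antisym (foldr-⊔-≤ (distance G con u) bound) (≤-foldr-⊔ (distance G con u) v)

  eccentricityMatrix-eq : ∀ u v → distance G con u v ≡ eccentricity G con u ⊓ eccentricity G con v →
                          eccentricityMatrix G con u v ≡ fromℕ (distance G con u v)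
  eccentricityMatrix-eq u v eq =
    cong (if_then fromℕ (distance G con u v) else 0ℚ) (dec-true (_ ℕ.≟ _) eq)

  eccentricityMatrix-≢ : ∀ u v → distance G con u v ≢ eccentricity G con u ⊓ eccentricity G con v →
                         eccentricityMatrix G con u v ≡ 0ℚ
  eccentricityMatrix-≢ u v neq =
    cong (if_then fromℕ (distance G con u v) else 0ℚ) (dec-false (_ ℕ.≟ _) neq)

-- The eccentricity matrix of the wheel.

nonneighbour : ∀ {m} → 7 ≤ m → (i : Fin m) →
               ∃[ j ] (i ≢ j × ¬ CyclicSuc m i j × ¬ CyclicSuc m j i)
nonneighbour {m} 7≤m i with toℕ i ℕ.≤? 4
... | yes i≤4 = j , (λ eq → ℕ.m≢1+n+m (toℕ i) {1} (trans (cong toℕ eq) ≡j)) , ¬ij , ¬ji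
  where
  -- Two steps ahead of `i`: the index is at most 6, so `7 ≤ m` keeps it in range.
  j : Fin m
  j = Fin.fromℕ< {2 ℕ.+ toℕ i} (ℕ.≤-trans (ℕ.+-monoʳ-≤ 3 i≤4) 7≤m)
  ≡j : toℕ j ≡ 2 ℕ.+ toℕ i
  ≡j = Fin.toℕ-fromℕ< _
  ¬ij : ¬ CyclicSuc m i j
  ¬ij (inj₁ e) = ℕ.1+n≢n (trans (sym ≡j) e)
  ¬ij (inj₂ (_ , e)) = ℕ.1+n≢0 (trans (sym ≡j) e)
  ¬ji : ¬ CyclicSuc m j i
  ¬ji (inj₁ e) = ℕ.m≢1+n+m (toℕ i) {2} (trans e (cong suc ≡j))
  ¬ji (inj₂ (e , z)) = ℕ.<⇒≢ (ℕ.≤-trans (ℕ.m≤n+m 4 3) 7≤m)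
    (trans (sym (trans (cong suc ≡j) (cong (3 ℕ.+_) z))) e)
... | no i≰4 = j , (λ eq → ≢i (s≤s (s≤s (s≤s z≤n))) (trans (cong toℕ eq) ≡j)) , ¬ij , ¬ji
  where
  -- Vertex 2 has only the neighbours 1 and 3, while `i` is at least 5.
  j : Fin m
  j = Fin.fromℕ< {2} (ℕ.≤-trans (ℕ.m≤n+m 3 4) 7≤m)
  ≡j : toℕ j ≡ 2
  ≡j = Fin.toℕ-fromℕ< _
  ≢i : ∀ {l} → l < 5 → toℕ i ≢ l
  ≢i l<5 refl = i≰4 (ℕ.s≤s⁻¹ l<5)
  ¬ij : ¬ CyclicSuc m i j
  ¬ij (inj₁ e) = ≢i {1} (s≤s (s≤s z≤n)) (ℕ.suc-injective (trans (sym e) ≡j))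
  ¬ij (inj₂ (_ , e)) = ℕ.1+n≢0 (trans (sym ≡j) e)
  ¬ji : ¬ CyclicSuc m j i
  ¬ji (inj₁ e) = ≢i {3} (s≤s (s≤s (s≤s (s≤s z≤n)))) (trans e (cong suc ≡j))
  ¬ji (inj₂ (_ , z)) = ≢i {0} (s≤s z≤n) z

-- The four cases match the possible values of the identity entries in `rimE`. `predecessor` carries
-- `¬ CyclicSuc m i j` to make the `next` entry vanish; for `successor` the `prev` entry is handled
-- by `next≢prev`.
data Separation {m} (i : Fin m) : Fin m → Set where
  coincident  : Separation i i
  successor   : ∀ {j} → i ≢ j → CyclicSuc m i j → Separation i j
  predecessor : ∀ {j} → i ≢ j → ¬ CyclicSuc m i j → CyclicSuc m j i → Separation i j
  apart       : ∀ {j} → i ≢ j → ¬ CyclicSuc m i j → ¬ CyclicSuc m j i → Separation i j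

separation : ∀ {m} (i j : Fin m) → Separation i j
separation {m} i j with i Fin.≟ j | cyclicSuc? m i j | cyclicSuc? m j i
... | yes refl | _      | _      = coincident
... | no i≢j   | yes ij | _      = successor i≢j ij
... | no i≢j   | no ¬ij | yes ji = predecessor i≢j ¬ij ji
... | no i≢j   | no ¬ij | no ¬ji = apart i≢j ¬ij ¬ji

-- The adjacency matrix of the cycle is split into its two shift permutation matrices, so that
-- multiplying a column by it just selects two entries.
rimE : ∀ {k} → Matrix (suc k) (suc k)
rimE i j = fromℕ 2 * (1ℚ - (𝐈 i j + (𝐈 (next i) j + 𝐈 (prev i) j)))

-- con is arbitrary, so that distances do not reduce.
module _ {k : ℕ} (7≤m : 7 ≤ suc k) (3≤m : 3 ≤ suc k)
         (con : Connected (cone (cycle (suc k) 3≤m))) where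

  private
    m = suc k
    W = cone (cycle m 3≤m)
    d = distance W con
    e = eccentricity W con

  rim-distance : ∀ {i j : Fin m} → i ≢ j → ¬ CyclicSuc m i j → ¬ CyclicSuc m j i →
                 d (suc i) (suc j) ≡ 2
  rim-distance i≢j ¬ij ¬ji = distance-via W con rim-hub hub-rim
    (λ eq → i≢j (Fin.suc-injective eq))
    (λ where (rim-rim (inj₁ s)) → ¬ij s
             (rim-rim (inj₂ s)) → ¬ji s)

  rim-distance-≤ : ∀ (i j : Fin m) → d (suc i) (suc j) ≤ 2
  rim-distance-≤ i j with separation i j
  ... | coincident = ℕ.≤-trans (ℕ.≤-reflexive (distance-refl W con (suc i))) z≤n
  ... | successor _ s = ℕ.≤-trans (ℕ.≤-reflexive (distance-adjacent W con (rim-rim (inj₁ s)))) (s≤s z≤n)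
  ... | predecessor _ _ s = ℕ.≤-trans (ℕ.≤-reflexive (distance-adjacent W con (rim-rim (inj₂ s)))) (s≤s z≤n)
  ... | apart i≢j ¬ij ¬ji = ℕ.≤-reflexive (rim-distance i≢j ¬ij ¬ji)

  hub-eccentricity : e zero ≡ 1
  hub-eccentricity = eccentricity-unique W con {v = suc zero}
    (λ where
      zero    → ℕ.≤-trans (ℕ.≤-reflexive (distance-refl W con zero)) z≤n
      (suc j) → ℕ.≤-reflexive (distance-adjacent W con hub-rim))
    (distance-adjacent W con hub-rim)

  rim-eccentricity : ∀ i → e (suc i) ≡ 2
  rim-eccentricity i = let j , i≢j , ¬ij , ¬ji = nonneighbour 7≤m i in
    eccentricity-unique W con {v = suc j}
      (λ where
        zero    → ℕ.≤-trans (ℕ.≤-reflexive (distance-adjacent W con rim-hub)) (s≤s z≤n)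
        (suc j) → rim-distance-≤ i j)
      (rim-distance i≢j ¬ij ¬ji)

  private
    -- Two rim eccentricities have minimum 2, which distances 0 and 1 do not reach.
    rim-entry : ∀ i j {l} → d (suc i) (suc j) ≡ l → l < 2 → eccentricityMatrix W con (suc i) (suc j) ≡ 0ℚ
    rim-entry i j dist l<2 = eccentricityMatrix-≢ W con (suc i) (suc j) λ eq → ℕ.<⇒≢ l<2
      (trans (sym dist) (trans eq (cong₂ _⊓_ (rim-eccentricity i) (rim-eccentricity j))))

    -- With numerals in place of the three identity entries, the remaining equation is a closed
    -- computation.
    rimE-value : ∀ (i j : Fin m) a b c {x} → fromℕ 2 * (1ℚ - (a + (b + c))) ≡ x →
                 𝐈 i j ≡ a → 𝐈 (next i) j ≡ b → 𝐈 (prev i) j ≡ c → rimE i j ≡ x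
    rimE-value _ _ _ _ _ eq refl refl refl = eq

  rim-block : ∀ {i j} → Separation i j → eccentricityMatrix W con (suc i) (suc j) ≡ rimE i j
  rim-block {i} coincident = trans
    (rim-entry i i (distance-refl W con (suc i)) (s≤s z≤n))
    (sym (rimE-value i i 1ℚ 0ℚ 0ℚ refl (𝐈-diag i)
      (𝐈-off-diag λ eq → cyclicSuc-irreflexive m 3≤m (subst (CyclicSuc m i) eq (cyclicSuc-next i)))
      (𝐈-off-diag λ eq → cyclicSuc-irreflexive m 3≤m (subst (λ h → CyclicSuc m h i) eq (cyclicSuc-prev i)))))
  rim-block {i} {j} (successor i≢j s) = trans
    (rim-entry i j (distance-adjacent W con (rim-rim (inj₁ s))) (s≤s (s≤s z≤n)))
    (sym (rimE-value i j 0ℚ 1ℚ 0ℚ refl (𝐈-off-diag i≢j)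
      (trans (cong (λ h → 𝐈 h j) (cyclicSuc⇒next s)) (𝐈-diag j))
      -- For `m = 2` both neighbours would coincide and the entry of `rimE` would be -2 instead of
      -- 0.
      (𝐈-off-diag λ eq → next≢prev 3≤m i (trans (cyclicSuc⇒next s) (sym eq)))))
  rim-block {i} {j} (predecessor i≢j ¬ij s) = trans
    (rim-entry i j (distance-adjacent W con (rim-rim (inj₂ s))) (s≤s (s≤s z≤n)))
    (sym (rimE-value i j 0ℚ 0ℚ 1ℚ refl (𝐈-off-diag i≢j)
      (𝐈-off-diag λ eq → ¬ij (subst (CyclicSuc m i) eq (cyclicSuc-next i)))
      (trans (cong (λ h → 𝐈 h j) (cyclicSuc⇒prev s)) (𝐈-diag j))))
  rim-block {i} {j} (apart i≢j ¬ij ¬ji) = trans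
    (trans (eccentricityMatrix-eq W con (suc i) (suc j)
             (trans dist (sym (cong₂ _⊓_ (rim-eccentricity i) (rim-eccentricity j)))))
           (cong fromℕ dist))
    (sym (rimE-value i j 0ℚ 0ℚ 0ℚ refl (𝐈-off-diag i≢j)
      (𝐈-off-diag λ eq → ¬ij (subst (CyclicSuc m i) eq (cyclicSuc-next i)))
      (𝐈-off-diag λ eq → ¬ji (subst (λ h → CyclicSuc m h i) eq (cyclicSuc-prev i)))))
    where dist = rim-distance i≢j ¬ij ¬ji

  eccentricityMatrix-wheel : eccentricityMatrix W con ≈ᴹ block 0ℚ 𝐞 𝐞 rimE
  eccentricityMatrix-wheel zero zero = eccentricityMatrix-≢ W con zero zero λ eq → ℕ.0≢1+n
    (trans (sym (distance-refl W con zero)) (trans eq (cong₂ _⊓_ hub-eccentricity hub-eccentricity)))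
  -- The hub has eccentricity 1 and the rim 2, so the distance 1 equals the minimum and the entry is
  -- kept.
  eccentricityMatrix-wheel zero (suc j) = trans
    (eccentricityMatrix-eq W con zero (suc j)
      (trans dist (sym (cong₂ _⊓_ hub-eccentricity (rim-eccentricity j)))))
    (cong fromℕ dist)
    where dist = distance-adjacent W con (hub-rim {i = j})
  eccentricityMatrix-wheel (suc i) zero = trans
    (eccentricityMatrix-eq W con (suc i) zero
      (trans dist (sym (cong₂ _⊓_ (rim-eccentricity i) hub-eccentricity))))
    (cong fromℕ dist)
    where dist = distance-adjacent W con (rim-hub {i = i})
  eccentricityMatrix-wheel (suc i) (suc j) = rim-block (separation i j)

-- Toeplitz matrices of periodic patterns.

-- What the two residue cases of `n` have in common. `palindromic` makes differences behave
-- cyclically; `central-sum` is the sum over a vertex and its two neighbours, which both see the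
-- value `P 1`.
record IsKernel (m : ℕ) (P : ℕ → ℚ) : Set where
  field
    palindromic  : ∀ a b → a ℕ.+ b ≡ m → P a ≡ P b
    triple-sum   : ∀ a → P a + (P (2 ℕ.+ a) + P (1 ℕ.+ a)) ≡ 0ℚ
    central-sum  : P 0 + (P 1 + P 1) ≡ fromℕ 3

toeplitz : ∀ {m} → (ℕ → ℚ) → Matrix m m
toeplitz P i j = P ∣ toℕ i - toℕ j ∣

toeplitz-sym : ∀ {m} P (i j : Fin m) → toeplitz P i j ≡ toeplitz P j i
toeplitz-sym P i j = cong P (ℕ.∣-∣-comm (toℕ i) (toℕ j))

-- Rotation moves every entry one step down the diagonal, which keeps the index difference. Symmetry
-- is required at positive indices only, since the first entry of `x̄` or `ȳ` breaks it at 0.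
Circ-toeplitz : ∀ {k} (g : ℕ → ℚ) (c : Vector ℚ (suc k)) →
                (∀ j → c j ≡ g (toℕ j)) →
                (∀ a b → suc a ℕ.+ suc b ≡ suc k → g (suc a) ≡ g (suc b)) →
                Circ c ≈ᴹ toeplitz g
Circ-toeplitz {k} g c c≗g pal i = rotated (toℕ i) (Fin.toℕ<n i)
  where
  rotated : ∀ t → t < suc k → ∀ j → fold c rotateRight t j ≡ g ∣ t - toℕ j ∣
  rotated zero    _    j       = c≗g j
  rotated (suc t) t<m  (suc j) = trans
    (rotated t (ℕ.<⇒≤ t<m) (inject₁ j))
    (cong (λ h → g ∣ t - h ∣) (Fin.toℕ-inject₁ j))
  -- The entry wrapping into column 0 comes from the last column `k` of row `t`, at difference
  -- `k - t`; symmetry turns this into `t + 1`.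
  rotated (suc t) t<m  zero    = begin
    fold c rotateRight t (Fin.fromℕ k)  ≡⟨ rotated t (ℕ.<⇒≤ t<m) (Fin.fromℕ k) ⟩
    g ∣ t - toℕ (Fin.fromℕ k) ∣         ≡⟨ cong (λ h → g ∣ t - h ∣) (Fin.toℕ-fromℕ k) ⟩
    g ∣ t - k ∣                         ≡⟨ cong g (ℕ.m≤n⇒∣m-n∣≡n∸m (ℕ.<⇒≤ t<k)) ⟩
    g (k ℕ.∸ t)                         ≡⟨ cong g k∸t ⟨
    g (suc (k ℕ.∸ suc t))               ≡⟨ pal _ t (cong suc (trans (ℕ.+-comm _ (suc t)) (ℕ.m+[n∸m]≡n t<k))) ⟩
    g (suc t)                           ∎
    where
    open ≡-Reasoning
    t<k : t < k
    t<k = ℕ.s≤s⁻¹ t<m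
    k∸t : suc (k ℕ.∸ suc t) ≡ k ℕ.∸ t
    k∸t = sym (ℕ.+-∸-assoc 1 t<k)

-- The first entry of x̄ or ȳ is that of the periodic pattern lowered by m.
spike : ℚ → (ℕ → ℚ) → ℕ → ℚ
spike x P zero    = P zero - x
spike x P (suc a) = P (suc a)

-- Difference 0 occurs exactly on the diagonal, so lowering `P 0` subtracts a multiple of the
-- identity.
toeplitz-spike : ∀ {m} x P (i j : Fin m) →
                 toeplitz (spike x P) i j ≡ toeplitz P i j - x * 𝐈 i j
toeplitz-spike x P zero zero = cong (λ h → P 0 - h) (sym (ℚ.*-identityʳ x))
toeplitz-spike x P zero (suc j) = solve 2 (λ p x → p := p :- x :* con 0ℚ) refl (P (suc (toℕ j))) x
  where open +-*-Solver
toeplitz-spike x P (suc i) zero = solve 2 (λ p x → p := p :- x :* con 0ℚ) refl (P (suc (toℕ i))) x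
  where open +-*-Solver
toeplitz-spike x P (suc i) (suc j) = toeplitz-spike x P i j

module _ {k : ℕ} {P : ℕ → ℚ} (kernel : IsKernel (suc k) P) where
  open IsKernel kernel

  private
    K : Matrix (suc k) (suc k)
    K = toeplitz P

  -- Only the last row wraps, to row 0, and there `palindromic` exchanges `j` for `m - j`. The
  -- neighbour may thus be treated as the plain integer `i + 1`.
  toeplitz-next : ∀ i j → K (next i) j ≡ P ∣ suc (toℕ i) - toℕ j ∣
  toeplitz-next i j with view i
  ... | ‵inject₁ i = cong (λ h → P ∣ suc h - toℕ j ∣) (sym (Fin.toℕ-inject₁ i))
  ... | ‵fromℕ     = begin
    P (toℕ j)                ≡⟨ palindromic _ _ (ℕ.m+[n∸m]≡n j≤m) ⟩
    P (suc k ℕ.∸ toℕ j)      ≡⟨ cong P (ℕ.m≤n⇒∣m-n∣≡n∸m j≤m) ⟨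
    P ∣ toℕ j - suc k ∣      ≡⟨ cong P (ℕ.∣-∣-comm (toℕ j) (suc k)) ⟩
    P ∣ suc k - toℕ j ∣      ≡⟨ cong (λ h → P ∣ suc h - toℕ j ∣) (Fin.toℕ-fromℕ k) ⟨
    P ∣ suc (toℕ (Fin.fromℕ k)) - toℕ j ∣  ∎
    where
    open ≡-Reasoning
    j≤m : toℕ j ≤ suc k
    j≤m = ℕ.<⇒≤ (Fin.toℕ<n j)

  toeplitz-prev : ∀ i j → K (prev i) j ≡ P ∣ toℕ i - suc (toℕ j) ∣
  toeplitz-prev (suc i) j = cong (λ h → P ∣ h - toℕ j ∣) (Fin.toℕ-inject₁ i)
  toeplitz-prev zero    j = begin
    P ∣ toℕ (Fin.fromℕ k) - toℕ j ∣  ≡⟨ cong (λ h → P ∣ h - toℕ j ∣) (Fin.toℕ-fromℕ k) ⟩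
    P ∣ k - toℕ j ∣                  ≡⟨ cong P (ℕ.∣-∣-comm k (toℕ j)) ⟩
    P ∣ toℕ j - k ∣                  ≡⟨ cong P (ℕ.m≤n⇒∣m-n∣≡n∸m j≤k) ⟩
    P (k ℕ.∸ toℕ j)                  ≡⟨ palindromic _ _ (trans (ℕ.+-suc _ _) (cong suc (ℕ.m∸n+n≡m j≤k))) ⟩
    P (suc (toℕ j))                  ∎
    where
    open ≡-Reasoning
    j≤k : toℕ j ≤ k
    j≤k = Fin.toℕ≤pred[n] j

  private
    -- With wrap-around gone, both indices can be lowered together until one is 0. The diagonal then
    -- meets `central-sum`, and every other place meets three consecutive values of `P`.
    neighbours : ∀ {m} (i j : Fin m) →
      P ∣ toℕ i - toℕ j ∣ + (P ∣ suc (toℕ i) - toℕ j ∣ + P ∣ toℕ i - suc (toℕ j) ∣) ≡ fromℕ 3 * 𝐈 i j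
    neighbours zero    zero    = central-sum
    neighbours zero    (suc j) = trans
      (solve 3 (λ a b c → a :+ (b :+ c) := b :+ (c :+ a)) refl
        (P (1 ℕ.+ toℕ j)) (P (toℕ j)) (P (2 ℕ.+ toℕ j)))
      (triple-sum (toℕ j))
      where open +-*-Solver
    neighbours (suc i) zero    = trans
      (cong (λ h → P (1 ℕ.+ toℕ i) + (P (2 ℕ.+ toℕ i) + P h)) (ℕ.∣-∣-identityʳ (toℕ i)))
      (trans
        (solve 3 (λ a b c → a :+ (b :+ c) := c :+ (b :+ a)) refl
          (P (1 ℕ.+ toℕ i)) (P (2 ℕ.+ toℕ i)) (P (toℕ i)))
        (triple-sum (toℕ i)))
      where open +-*-Solver
    neighbours (suc i) (suc j) = neighbours i j

  toeplitz-neighbours : ∀ i j → K i j + (K (next i) j + K (prev i) j) ≡ fromℕ 3 * 𝐈 i j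
  toeplitz-neighbours i j = trans
    (cong (λ h → K i j + h) (cong₂ _+_ (toeplitz-next i j) (toeplitz-prev i j)))
    (neighbours i j)

  -- Rotating a column preserves its sum, so adding up the neighbour identities gives three times
  -- the column sum on one side and 3 on the other.
  sum-toeplitz : ∀ j → sum (λ i → K i j) ≡ 1ℚ
  sum-toeplitz j = begin
    S
      ≡⟨ solve 1 (λ s → s := con ⅓ :* (s :+ (s :+ s))) refl S ⟩
    ⅓ * (S + (S + S))
      ≡⟨ cong (λ h → ⅓ * (S + h)) (cong₂ _+_ (sum-∘-next col) (sum-∘-prev col)) ⟨
    ⅓ * (S + (sum (col ∘ next) + sum (col ∘ prev)))
      ≡⟨ cong (λ h → ⅓ * (S + h)) (∑-distrib-+ (col ∘ next) (col ∘ prev)) ⟨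
    ⅓ * (S + sum (λ i → col (next i) + col (prev i)))
      ≡⟨ cong (⅓ *_) (∑-distrib-+ col (λ i → col (next i) + col (prev i))) ⟨
    ⅓ * sum (λ i → col i + (col (next i) + col (prev i)))
      ≡⟨ cong (⅓ *_) (sum-cong-≗ (λ i → trans (toeplitz-neighbours i j)
           (trans (ℚ.*-comm (fromℕ 3) (𝐈 i j)) (cong (_* fromℕ 3) (𝐈-sym i j))))) ⟩
    ⅓ * sum (λ i → 𝐈 j i * fromℕ 3)
      ≡⟨ cong (⅓ *_) (sum-𝐈 j (λ _ → fromℕ 3)) ⟩
    ⅓ * fromℕ 3
      ∎
    where
    open ≡-Reasoning
    open +-*-Solver
    col : Vector ℚ (suc k)
    col i = K i j
    S = sum col

-- Multiplication by the rim block, and symmetry.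

sum-* : ∀ {n} c (f : Vector ℚ n) → sum (λ i → c * f i) ≡ c * sum f
sum-* c f = sym (*-distribˡ-sum c f)

sum-rimE : ∀ {k} (i : Fin (suc k)) (f : Vector ℚ (suc k)) →
           sum (λ j → rimE i j * f j) ≡ fromℕ 2 * (sum f - (f i + (f (next i) + f (prev i))))
sum-rimE i f = begin
  sum (λ j → rimE i j * f j)
    -- Differences become sums with the factor `- 1ℚ`, the shape to which `∑-distrib-+` and `sum-*`
    -- apply.
    ≡⟨ sum-cong-≗ (λ j → solve 4
         (λ a b c x → con (fromℕ 2) :* (con 1ℚ :- (a :+ (b :+ c))) :* x :=
                      con (fromℕ 2) :* (x :+ con (- 1ℚ) :* (a :* x :+ (b :* x :+ c :* x))))
         refl (𝐈 i j) (𝐈 (next i) j) (𝐈 (prev i) j) (f j)) ⟩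
  sum (λ j → fromℕ 2 * (f j + - 1ℚ * ring j))
    ≡⟨ sum-* (fromℕ 2) (λ j → f j + - 1ℚ * ring j) ⟩
  fromℕ 2 * sum (λ j → f j + - 1ℚ * ring j)
    ≡⟨ cong (fromℕ 2 *_) (∑-distrib-+ f (λ j → - 1ℚ * ring j)) ⟩
  fromℕ 2 * (sum f + sum (λ j → - 1ℚ * ring j))
    ≡⟨ cong (λ s → fromℕ 2 * (sum f + s)) (sum-* (- 1ℚ) ring) ⟩
  fromℕ 2 * (sum f + - 1ℚ * sum ring)
    ≡⟨ cong (λ s → fromℕ 2 * (sum f + - 1ℚ * s)) sum-ring ⟩
  fromℕ 2 * (sum f + - 1ℚ * (f i + (f (next i) + f (prev i))))
    ≡⟨ solve 2 (λ s x → con (fromℕ 2) :* (s :+ con (- 1ℚ) :* x) := con (fromℕ 2) :* (s :- x))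
         refl (sum f) (f i + (f (next i) + f (prev i))) ⟩
  fromℕ 2 * (sum f - (f i + (f (next i) + f (prev i))))
    ∎
  where
  open ≡-Reasoning
  open +-*-Solver
  row : Fin _ → Vector ℚ _
  row h j = 𝐈 h j * f j
  ring : Vector ℚ _
  ring j = row i j + (row (next i) j + row (prev i) j)
  sum-ring : sum ring ≡ f i + (f (next i) + f (prev i))
  sum-ring = trans
    (∑-distrib-+ (row i) (λ j → row (next i) j + row (prev i) j))
    (cong₂ _+_ (sum-𝐈 i f)
      (trans (∑-distrib-+ (row (next i)) (row (prev i)))
             (cong₂ _+_ (sum-𝐈 (next i) f) (sum-𝐈 (prev i) f))))

Symmetric : ∀ {n} → Matrix n n → Set
Symmetric A = ∀ i j → A i j ≡ A j i

block-sym : ∀ {n} a (v : Vector ℚ n) {D} → Symmetric D → Symmetric (block a v v D)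
block-sym a v D-sym zero    zero    = refl
block-sym a v D-sym zero    (suc j) = refl
block-sym a v D-sym (suc i) zero    = refl
block-sym a v D-sym (suc i) (suc j) = D-sym i j

-- For symmetric factors `B ⊠ A` is the transpose of `A ⊠ B`.
symmetric-inverse : ∀ {n} {A B : Matrix n n} → Symmetric A → Symmetric B →
                    A ⊠ B ≈ᴹ 𝐈 → A HasInverse B
symmetric-inverse {A = A} {B} A-sym B-sym AB≈𝐈 = AB≈𝐈 , λ i j → begin
  sum (λ k → B i k * A k j)  ≡⟨ sum-cong-≗ (λ k → trans (ℚ.*-comm (B i k) (A k j)) (cong₂ _*_ (A-sym k j) (B-sym i k))) ⟩
  sum (λ k → A j k * B k i)  ≡⟨ AB≈𝐈 j i ⟩
  𝐈 j i                      ≡⟨ 𝐈-sym j i ⟩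
  𝐈 i j                      ∎
  where open ≡-Reasoning

⊠-cong : ∀ {l m n} {A A′ : Matrix l m} {B B′ : Matrix m n} → A ≈ᴹ A′ → B ≈ᴹ B′ → A ⊠ B ≈ᴹ A′ ⊠ B′
⊠-cong A≈ B≈ i j = sum-cong-≗ (λ k → cong₂ _*_ (A≈ i k) (B≈ k j))

HasInverse-resp-≈ᴹ : ∀ {n} {A A′ B B′ : Matrix n n} → A ≈ᴹ A′ → B ≈ᴹ B′ →
                     A′ HasInverse B′ → A HasInverse B
HasInverse-resp-≈ᴹ A≈ B≈ (AB , BA) =
  (λ i j → trans (⊠-cong A≈ B≈ i j) (AB i j)) , (λ i j → trans (⊠-cong B≈ A≈ i j) (BA i j))

-- Inverse permutations have transposed matrices; transposing `rimE` therefore swaps its two shift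
-- terms.
𝐈-next-prev : ∀ {k} (i j : Fin (suc k)) → 𝐈 (next i) j ≡ 𝐈 (prev j) i
𝐈-next-prev i j with next i Fin.≟ j
... | yes refl = sym (trans (cong (λ h → 𝐈 h i) (prev-next i)) (𝐈-diag i))
... | no  ≢j   = sym (𝐈-off-diag λ eq → ≢j (trans (cong next (sym eq)) (next-prev j)))

rimE-sym : ∀ {k} → Symmetric (rimE {k})
rimE-sym i j = cong (λ h → fromℕ 2 * (1ℚ - h))
  (cong₂ _+_ (𝐈-sym i j)
    (trans (cong₂ _+_ (𝐈-next-prev i j) (sym (𝐈-next-prev j i)))
           (ℚ.+-comm (𝐈 (prev j) i) (𝐈 (next j) i))))

-- The claimed inverse simplified by `r * m ≡ 6`. For instance, the corner is
-- `r (1 - m/6)² - m/6 = r - 2`.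
inverseE : ∀ {m} → ℚ → (ℕ → ℚ) → Matrix (suc m) (suc m)
inverseE r P = block (r - fromℕ 2) (λ _ → r * ⅙) (λ _ → r * ⅙)
                     (λ i j → ⅙ * (r * ⅙ - toeplitz P i j))

-- The product with the simplified inverse, and its agreement with the stated formula.

module _ {k : ℕ} {P : ℕ → ℚ} (kernel : IsKernel (suc k) P)
         (r : ℚ) (r*m≡6 : r * fromℕ (suc k) ≡ fromℕ 6) where

  private
    m = suc k
    ι = fromℕ m
    K N : Matrix m m
    K = toeplitz P
    N i j = ⅙ * (r * ⅙ - K i j)

  open ≡-Reasoning
  open +-*-Solver

  -- The constant part of a column adds up to `m * r / 6 = 1`, which cancels the column sum of `K`.
  -- This annihilates both the hub row and the all-ones part of `rimE`.
  sum-N : ∀ j → sum (λ i → N i j) ≡ 0ℚ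
  sum-N j = begin
    sum (λ i → N i j)
      ≡⟨ sum-* ⅙ (λ i → r * ⅙ - K i j) ⟩
    ⅙ * sum (λ i → r * ⅙ - K i j)
      ≡⟨ cong (⅙ *_) (sum-cong-≗ (λ i → solve 2 (λ a b → a :- b := a :+ con (- 1ℚ) :* b) refl (r * ⅙) (K i j))) ⟩
    ⅙ * sum (λ i → r * ⅙ + - 1ℚ * K i j)
      ≡⟨ cong (⅙ *_) (∑-distrib-+ {m} (λ _ → r * ⅙) (λ i → - 1ℚ * K i j)) ⟩
    ⅙ * (sum {m} (λ _ → r * ⅙) + sum (λ i → - 1ℚ * K i j))
      ≡⟨ cong (⅙ *_) (cong₂ _+_ (sum-const m (r * ⅙))
           (trans (sum-* (- 1ℚ) (λ i → K i j)) (cong (- 1ℚ *_) (sum-toeplitz kernel j)))) ⟩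
    ⅙ * (ι * (r * ⅙) + - 1ℚ * 1ℚ)
      ≡⟨ solve 2 (λ ι r → con ⅙ :* (ι :* (r :* con ⅙) :+ con (- 1ℚ) :* con 1ℚ) :=
                          con ⅙ :* (r :* ι :* con ⅙ :+ con (- 1ℚ))) refl ι r ⟩
    ⅙ * (r * ι * ⅙ + - 1ℚ)
      ≡⟨ cong (λ h → ⅙ * (h * ⅙ + - 1ℚ)) r*m≡6 ⟩
    0ℚ
      ∎

  product-identity : block 0ℚ 𝐞 𝐞 rimE ⊠ inverseE {m} r P ≈ᴹ 𝐈
  product-identity zero zero = begin
    0ℚ * (r - fromℕ 2) + sum {m} (λ _ → 1ℚ * (r * ⅙))
      ≡⟨ cong (0ℚ * (r - fromℕ 2) +_) (sum-const m (1ℚ * (r * ⅙))) ⟩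
    0ℚ * (r - fromℕ 2) + ι * (1ℚ * (r * ⅙))
      ≡⟨ solve 2 (λ ι r → con 0ℚ :* (r :- con (fromℕ 2)) :+ ι :* (con 1ℚ :* (r :* con ⅙)) :=
                          r :* ι :* con ⅙) refl ι r ⟩
    r * ι * ⅙
      ≡⟨ cong (_* ⅙) r*m≡6 ⟩
    1ℚ
      ∎
  product-identity zero (suc j) = begin
    0ℚ * (r * ⅙) + sum (λ i → 1ℚ * N i j)
      ≡⟨ cong₂ _+_ (ℚ.*-zeroˡ (r * ⅙)) (sum-cong-≗ (λ i → ℚ.*-identityˡ (N i j))) ⟩
    0ℚ + sum (λ i → N i j)
      ≡⟨ cong (0ℚ +_) (sum-N j) ⟩
    0ℚ
      ∎
  -- The constant column `r / 6` has sum 1, so `rimE` sends it to `2 (1 - r / 2) = 2 - r`, the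
  -- opposite of the corner entry.
  product-identity (suc i) zero = begin
    1ℚ * (r - fromℕ 2) + sum (λ j → rimE i j * (r * ⅙))
      ≡⟨ cong (1ℚ * (r - fromℕ 2) +_) (trans (sum-rimE i (λ _ → r * ⅙))
           (cong (λ s → fromℕ 2 * (s - (r * ⅙ + (r * ⅙ + r * ⅙)))) (sum-const m (r * ⅙)))) ⟩
    1ℚ * (r - fromℕ 2) + fromℕ 2 * (ι * (r * ⅙) - (r * ⅙ + (r * ⅙ + r * ⅙)))
      ≡⟨ solve 2 (λ ι r → con 1ℚ :* (r :- con (fromℕ 2)) :+
                          con (fromℕ 2) :* (ι :* (r :* con ⅙) :- (r :* con ⅙ :+ (r :* con ⅙ :+ r :* con ⅙))) :=
                          r :* ι :* con ⅓ :- con (fromℕ 2)) refl ι r ⟩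
    r * ι * ⅓ - fromℕ 2
      ≡⟨ cong (λ h → h * ⅓ - fromℕ 2) r*m≡6 ⟩
    0ℚ
      ∎
  product-identity (suc i) (suc j) = begin
    1ℚ * (r * ⅙) + sum (λ l → rimE i l * N l j)
      ≡⟨ cong (1ℚ * (r * ⅙) +_) (trans (sum-rimE i (λ l → N l j))
           (cong (λ s → fromℕ 2 * (s - (N i j + (N (next i) j + N (prev i) j)))) (sum-N j))) ⟩
    1ℚ * (r * ⅙) + fromℕ 2 * (0ℚ - (N i j + (N (next i) j + N (prev i) j)))
      -- The three terms `r / 36`, doubled, cancel the border term `r / 6`, leaving only kernel
      -- values.
      ≡⟨ solve 4 (λ r a b c →
           con 1ℚ :* (r :* con ⅙) :+ con (fromℕ 2) :* (con 0ℚ :-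
             (con ⅙ :* (r :* con ⅙ :- a) :+ (con ⅙ :* (r :* con ⅙ :- b) :+ con ⅙ :* (r :* con ⅙ :- c)))) :=
           con ⅓ :* (a :+ (b :+ c))) refl r (K i j) (K (next i) j) (K (prev i) j) ⟩
    ⅓ * (K i j + (K (next i) j + K (prev i) j))
      ≡⟨ cong (⅓ *_) (toeplitz-neighbours kernel i j) ⟩
    ⅓ * (fromℕ 3 * 𝐈 i j)
      ≡⟨ solve 1 (λ x → con ⅓ :* (con (fromℕ 3) :* x) := x) refl (𝐈 i j) ⟩
    𝐈 i j
      ∎

  inverseE-correct : block 0ℚ 𝐞 𝐞 (rimE {k}) HasInverse inverseE r P
  inverseE-correct = symmetric-inverse (block-sym 0ℚ 𝐞 rimE-sym)
    (block-sym _ _ (λ i j → cong (λ h → ⅙ * (r * ⅙ - h)) (toeplitz-sym P i j)))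
    product-identity

  private
    -- The leading `⅙` is `- ½` times the border entry `- ⅓` of `L̃`, and it cancels the part of
    -- `r * w₁ * wⱼ` that contains `r * m`.
    border : ⅙ + r * (⅙ * (fromℕ 7 - fromℕ (suc m)) * ⅙) ≡ r * ⅙
    border = begin
      ⅙ + r * (⅙ * (fromℕ 7 - fromℕ (suc m)) * ⅙)
        ≡⟨ cong (λ n → ⅙ + r * (⅙ * (fromℕ 7 - n) * ⅙)) (fromℕ-suc m) ⟩
      ⅙ + r * (⅙ * (fromℕ 7 - (1ℚ + ι)) * ⅙)
        ≡⟨ solve 2 (λ r ι → con ⅙ :+ r :* (con ⅙ :* (con (fromℕ 7) :- (con 1ℚ :+ ι)) :* con ⅙) :=
                            r :* con ⅙ :+ (con ⅙ :- r :* ι :* (con ⅙ :* con ⅙))) refl r ι ⟩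
      r * ⅙ + (⅙ - r * ι * (⅙ * ⅙))
        ≡⟨ cong (λ h → r * ⅙ + (⅙ - h * (⅙ * ⅙))) r*m≡6 ⟩
      r * ⅙ + 0ℚ
        ≡⟨ ℚ.+-identityʳ (r * ⅙) ⟩
      r * ⅙
        ∎

  inverse-formula : (∀ i j → M m i j ≡ ⅓ * (toeplitz P i j - ι * 𝐈 i j)) →
                    (- ½) ∙ L̃ m ⊞ r ∙ outer (𝐰 m) (𝐰 m) ≈ᴹ inverseE r P
  inverse-formula M≡ zero zero = begin
    - ½ * ((fromℕ (suc m) - 1ℚ) * ⅓ * 1ℚ - ⅓ * 0ℚ + 0ℚ)
      + r * (⅙ * (fromℕ 7 - fromℕ (suc m)) * (⅙ * (fromℕ 7 - fromℕ (suc m))))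
      ≡⟨ cong (λ n → - ½ * ((n - 1ℚ) * ⅓ * 1ℚ - ⅓ * 0ℚ + 0ℚ) + r * (⅙ * (fromℕ 7 - n) * (⅙ * (fromℕ 7 - n))))
           (fromℕ-suc m) ⟩
    - ½ * ((1ℚ + ι - 1ℚ) * ⅓ * 1ℚ - ⅓ * 0ℚ + 0ℚ)
      + r * (⅙ * (fromℕ 7 - (1ℚ + ι)) * (⅙ * (fromℕ 7 - (1ℚ + ι))))
      -- The ring solver cannot use `r*m≡6`, so the product `r * ι` is first isolated as a factor.
      ≡⟨ solve 2 (λ r ι →
           con (- ½) :* ((con 1ℚ :+ ι :- con 1ℚ) :* con ⅓ :* con 1ℚ :- con ⅓ :* con 0ℚ :+ con 0ℚ)
             :+ r :* (con ⅙ :* (con (fromℕ 7) :- (con 1ℚ :+ ι)) :* (con ⅙ :* (con (fromℕ 7) :- (con 1ℚ :+ ι)))) :=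
           r :- con ⅙ :* ι :+ r :* ι :* (con ⅙ :* con ⅙ :* ι :- con ⅓)) refl r ι ⟩
    r - ⅙ * ι + r * ι * (⅙ * ⅙ * ι - ⅓)
      ≡⟨ cong (λ h → r - ⅙ * ι + h * (⅙ * ⅙ * ι - ⅓)) r*m≡6 ⟩
    r - ⅙ * ι + fromℕ 6 * (⅙ * ⅙ * ι - ⅓)
      ≡⟨ solve 2 (λ r ι → r :- con ⅙ :* ι :+ con (fromℕ 6) :* (con ⅙ :* con ⅙ :* ι :- con ⅓) :=
                          r :- con (fromℕ 2)) refl r ι ⟩
    r - fromℕ 2
      ∎
  inverse-formula M≡ zero (suc j) = trans
    (solve 2 (λ r n →
      con (- ½) :* ((n :- con 1ℚ) :* con ⅓ :* con 0ℚ :- con ⅓ :* con 1ℚ :+ con 0ℚ)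
        :+ r :* (con ⅙ :* (con (fromℕ 7) :- n) :* (con ⅙ :* con 1ℚ)) :=
      con ⅙ :+ r :* (con ⅙ :* (con (fromℕ 7) :- n) :* con ⅙)) refl r (fromℕ (suc m)))
    border
  inverse-formula M≡ (suc i) zero = trans
    (solve 2 (λ r n →
      con (- ½) :* ((n :- con 1ℚ) :* con ⅓ :* con 0ℚ :- con ⅓ :* con 1ℚ :+ con 0ℚ)
        :+ r :* ((con ⅙ :* con 1ℚ) :* (con ⅙ :* (con (fromℕ 7) :- n))) :=
      con ⅙ :+ r :* (con ⅙ :* (con (fromℕ 7) :- n) :* con ⅙)) refl r (fromℕ (suc m)))
    border
  inverse-formula M≡ (suc i) (suc j) = begin
    - ½ * ((fromℕ (suc m) - 1ℚ) * ⅓ * 𝐈 i j - ⅓ * 0ℚ + M m i j) + r * (⅙ * 1ℚ * (⅙ * 1ℚ))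
      ≡⟨ cong₂ (λ n x → - ½ * ((n - 1ℚ) * ⅓ * 𝐈 i j - ⅓ * 0ℚ + x) + r * (⅙ * 1ℚ * (⅙ * 1ℚ)))
           (fromℕ-suc m) (M≡ i j) ⟩
    - ½ * ((1ℚ + ι - 1ℚ) * ⅓ * 𝐈 i j - ⅓ * 0ℚ + ⅓ * (K i j - ι * 𝐈 i j)) + r * (⅙ * 1ℚ * (⅙ * 1ℚ))
      ≡⟨ solve 4 (λ r ι x p →
           con (- ½) :* ((con 1ℚ :+ ι :- con 1ℚ) :* con ⅓ :* x :- con ⅓ :* con 0ℚ
             :+ con ⅓ :* (p :- ι :* x)) :+ r :* (con ⅙ :* con 1ℚ :* (con ⅙ :* con 1ℚ)) :=
           con ⅙ :* (r :* con ⅙ :- p)) refl r ι (𝐈 i j) (K i j) ⟩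
    ⅙ * (r * ⅙ - K i j)
      ∎

-- The two concrete patterns and the circulant block.

periodic-shift : ∀ a b c k → periodic a b c (suc k) ≡ periodic b c a k
periodic-shift a b c 0 = refl
periodic-shift a b c 1 = refl
periodic-shift a b c 2 = refl
periodic-shift a b c (suc (suc (suc k))) = periodic-shift a b c k

periodic-triple-sum : ∀ a b c → a + (c + b) ≡ 0ℚ → ∀ k →
  periodic a b c k + (periodic a b c (2 ℕ.+ k) + periodic a b c (1 ℕ.+ k)) ≡ 0ℚ
periodic-triple-sum a b c eq 0 = eq
periodic-triple-sum a b c eq 1 = trans (solve 3 (λ a b c → b :+ (a :+ c) := a :+ (c :+ b)) refl a b c) eq
  where open +-*-Solver
periodic-triple-sum a b c eq 2 = trans (solve 3 (λ a b c → c :+ (b :+ a) := a :+ (c :+ b)) refl a b c) eq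
  where open +-*-Solver
periodic-triple-sum a b c eq (suc (suc (suc k))) = periodic-triple-sum a b c eq k

-- Only residues modulo 3 matter: `k + l` is 1 modulo 3, which pairs residue 0 with 1 and 2 with
-- itself.
periodic-palindromic₂ : ∀ p q k l → suc (k ℕ.+ l) % 3 ≡ 2 → periodic p p q k ≡ periodic p p q l
periodic-palindromic₂ p q 0 0 ()
periodic-palindromic₂ p q 0 1 _ = refl
periodic-palindromic₂ p q 0 2 ()
periodic-palindromic₂ p q 1 0 _ = refl
periodic-palindromic₂ p q 1 1 ()
periodic-palindromic₂ p q 1 2 ()
periodic-palindromic₂ p q 2 0 ()
periodic-palindromic₂ p q 2 1 ()
periodic-palindromic₂ p q 2 2 _ = refl
periodic-palindromic₂ p q 0 (suc (suc (suc l))) = periodic-palindromic₂ p q 0 l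
periodic-palindromic₂ p q 1 (suc (suc (suc l))) = periodic-palindromic₂ p q 1 l
periodic-palindromic₂ p q 2 (suc (suc (suc l))) = periodic-palindromic₂ p q 2 l
periodic-palindromic₂ p q (suc (suc (suc k))) l = periodic-palindromic₂ p q k l

-- Here `k + l` is 2 modulo 3, which pairs residue 0 with 2 and 1 with itself.
periodic-palindromic₀ : ∀ p q k l → suc (k ℕ.+ l) % 3 ≡ 0 → periodic p q p k ≡ periodic p q p l
periodic-palindromic₀ p q 0 0 ()
periodic-palindromic₀ p q 0 1 ()
periodic-palindromic₀ p q 0 2 _ = refl
periodic-palindromic₀ p q 1 0 ()
periodic-palindromic₀ p q 1 1 _ = refl
periodic-palindromic₀ p q 1 2 ()
periodic-palindromic₀ p q 2 0 _ = refl
periodic-palindromic₀ p q 2 1 ()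
periodic-palindromic₀ p q 2 2 ()
periodic-palindromic₀ p q 0 (suc (suc (suc l))) = periodic-palindromic₀ p q 0 l
periodic-palindromic₀ p q 1 (suc (suc (suc l))) = periodic-palindromic₀ p q 1 l
periodic-palindromic₀ p q 2 (suc (suc (suc l))) = periodic-palindromic₀ p q 2 l
periodic-palindromic₀ p q (suc (suc (suc k))) l = periodic-palindromic₀ p q k l

-- The tails of `x̄` and `ȳ` continued periodically one place to the left. The value at 0 is the
-- first entry plus `m`: `2 - n + m = 1` and `- n + m = - 1`.
Pˣ Pʸ : ℕ → ℚ
Pˣ = periodic 1ℚ 1ℚ (- fromℕ 2)
Pʸ = periodic (- 1ℚ) (fromℕ 2) (- 1ℚ)

Pˣ-kernel : ∀ {m} → suc m % 3 ≡ 2 → IsKernel m Pˣ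
Pˣ-kernel n%3≡2 = record
  { palindromic = λ where a b refl → periodic-palindromic₂ 1ℚ (- fromℕ 2) a b n%3≡2
  ; triple-sum  = periodic-triple-sum 1ℚ 1ℚ (- fromℕ 2) refl
  ; central-sum = refl
  }

Pʸ-kernel : ∀ {m} → suc m % 3 ≡ 0 → IsKernel m Pʸ
Pʸ-kernel n%3≡0 = record
  { palindromic = λ where a b refl → periodic-palindromic₀ (- 1ℚ) (fromℕ 2) a b n%3≡0
  ; triple-sum  = periodic-triple-sum (- 1ℚ) (fromℕ 2) (- 1ℚ) refl
  ; central-sum = refl
  }

Circ-kernel : ∀ {k P} → IsKernel (suc k) P → (c : Vector ℚ (suc k)) →
              c zero ≡ P 0 - fromℕ (suc k) → (∀ j → c (suc j) ≡ P (suc (toℕ j))) →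
              ∀ i j → Circ c i j ≡ toeplitz P i j - fromℕ (suc k) * 𝐈 i j
Circ-kernel {k} {P} kernel c c₀ cₛ i j = trans
  (Circ-toeplitz (spike (fromℕ (suc k)) P) c (λ where zero → c₀; (suc j) → cₛ j)
    (λ a b → IsKernel.palindromic kernel (suc a) (suc b)) i j)
  (toeplitz-spike (fromℕ (suc k)) P i j)

-- Hiding the pattern behind an existential confines the case split on `n` modulo 3 to this point.
M-toeplitz : ∀ k → suc (suc k) % 3 ≢ 1 →
  ∃[ P ] (IsKernel (suc k) P ×
          (∀ i j → M (suc k) i j ≡ ⅓ * (toeplitz P i j - fromℕ (suc k) * 𝐈 i j)))
M-toeplitz k n%3≢1 with suc (suc k) % 3 ℕ.≟ 2
... | yes n%3≡2 = Pˣ , Pˣ-kernel n%3≡2 , λ i j → trans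
  (cong (λ b → (if b then ⅓ ∙ Circ (x̄ (suc k)) else ⅓ ∙ Circ (ȳ (suc k))) i j)
    (dec-true (suc (suc k) % 3 ℕ.≟ 2) n%3≡2))
  (cong (⅓ *_) (Circ-kernel (Pˣ-kernel n%3≡2) (x̄ (suc k)) x̄₀
    (λ j → sym (periodic-shift 1ℚ 1ℚ (- fromℕ 2) (toℕ j))) i j))
  where
  x̄₀ : fromℕ 2 - fromℕ (suc (suc k)) ≡ 1ℚ - fromℕ (suc k)
  x̄₀ = trans (cong (λ h → fromℕ 2 - h) (fromℕ-suc (suc k)))
    (solve 1 (λ ι → con (fromℕ 2) :- (con 1ℚ :+ ι) := con 1ℚ :- ι) refl (fromℕ (suc k)))
    where open +-*-Solver
... | no n%3≢2 = Pʸ , Pʸ-kernel n%3≡0 , λ i j → trans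
  (cong (λ b → (if b then ⅓ ∙ Circ (x̄ (suc k)) else ⅓ ∙ Circ (ȳ (suc k))) i j)
    (dec-false (suc (suc k) % 3 ℕ.≟ 2) n%3≢2))
  (cong (⅓ *_) (Circ-kernel (Pʸ-kernel n%3≡0) (ȳ (suc k)) ȳ₀
    (λ j → sym (periodic-shift (- 1ℚ) (fromℕ 2) (- 1ℚ) (toℕ j))) i j))
  where
  n%3≡0 : suc (suc k) % 3 ≡ 0
  -- The bound 3 on the remainder is lowered twice, by excluding 2 and then 1.
  n%3≡0 = ℕ.n<1⇒n≡0 (ℕ.≤∧≢⇒< (ℕ.s≤s⁻¹ (ℕ.≤∧≢⇒< (ℕ.s≤s⁻¹ (m%n<n (suc (suc k)) 3)) n%3≢2)) n%3≢1)
  ȳ₀ : - fromℕ (suc (suc k)) ≡ - 1ℚ - fromℕ (suc k)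
  ȳ₀ = trans (cong -_ (fromℕ-suc (suc k)))
    (solve 1 (λ ι → :- (con 1ℚ :+ ι) := con (- 1ℚ) :- ι) refl (fromℕ (suc k)))
    where open +-*-Solver

theorem5p11 : (m : ℕ) → let n = suc m in (8≤n : 8 ≤ n) → n % 3 ≢ 1 →
    eccentricityMatrix (wheel m (8≤n⇒4≤n 8≤n)) (wheel-connected m (8≤n⇒4≤n 8≤n))
    HasInverse
    ((- ½) ∙ L̃ m ⊞ 6/[n-1] m 8≤n ∙ outer (𝐰 m) (𝐰 m))
theorem5p11 zero (s≤s ())
theorem5p11 m@(suc k) 8≤n n%3≢1 =
  let P , kernel , M≡ = M-toeplitz k n%3≢1
      4≤n = 8≤n⇒4≤n 8≤n
      r = 6/[n-1] m 8≤n
  in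
  HasInverse-resp-≈ᴹ
    {A = eccentricityMatrix (wheel m 4≤n) (wheel-connected m 4≤n)}
    {A′ = block 0ℚ 𝐞 𝐞 rimE}
    {B = (- ½) ∙ L̃ m ⊞ r ∙ outer (𝐰 m) (𝐰 m)}
    {B′ = inverseE r P}
    (eccentricityMatrix-wheel (ℕ.s≤s⁻¹ 8≤n) (ℕ.s≤s⁻¹ 4≤n) (wheel-connected m 4≤n))
    (inverse-formula kernel r (6/m*m≡6 k) M≡)
    (inverseE-correct kernel r (6/m*m≡6 k))
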